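{- Let $s$ and $t$ be integers with $4 \leq s \leq t$. Let $G$ be a multigraph and let $L(G)$ denote its line graph. If $\chi(L(G)) = s+t-1 > \omega(L(G))$, then $L(G)$ contains a clique $Q$ of size $s$ such that $\chi(L(G) - Q) \geq t + 1$.
   Context: A multigraph may have multiple edges between the same pair of vertices. The line graph $L(G)$ of a multigraph $G$ has vertex set $E(G)$, two distinct edges being adjacent in $L(G)$ if and only if they share at least one endpoint. $\chi(H)$ denotes the chromatic number and $\omega(H)$ the clique number (size of a largest clique) of a graph $H$; $L(G)-Q$ denotes the graph obtained from $L(G)$ by deleting the vertices of $Q$. -}

module Defs where

open import Data.Nat using (ℕ; _<_; _≤_)
open import Data.Fin using (Fin)
open import Data.Fin.Subset using (Subset; _∈_; _∉_; ∣_∣)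
open import Data.Product using (Σ; ∃; ∃-syntax; _×_; _,_; proj₁)
open import Data.Sum using (_⊎_)
open import Relation.Binary.PropositionalEquality using (_≡_; _≢_)
open import Relation.Nullary using (¬_)

-- A finite (loopless) multigraph: vertices Fin n, edges Fin m; edge e has
-- endpoints src e and tgt e (distinct). Parallel edges are allowed since
-- several edges may have the same endpoints.
record Multigraph : Set where
  field
    n     : ℕ
    m     : ℕ
    src   : Fin m → Fin n
    tgt   : Fin m → Fin n
    loopless : ∀ e → src e ≢ tgt e

open Multigraph public

Incident : (G : Multigraph) → Fin (n G) → Fin (m G) → Set
Incident G v e = (v ≡ src G e) ⊎ (v ≡ tgt G e)

LAdj : (G : Multigraph) → Fin (m G) → Fin (m G) → Set
LAdj G e f = (e ≢ f) × (∃[ v ] (Incident G v e × Incident G v f))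

Colourable : (V : Set) → (V → V → Set) → ℕ → Set
Colourable V Adj k = Σ (V → Fin k) λ c → ∀ u v → Adj u v → c u ≢ c v

HasChromaticNumber : (V : Set) → (V → V → Set) → ℕ → Set
HasChromaticNumber V Adj k = Colourable V Adj k × (∀ j → j < k → ¬ Colourable V Adj j)

ChromaticAtLeast : (V : Set) → (V → V → Set) → ℕ → Set
ChromaticAtLeast V Adj k = ∀ j → j < k → ¬ Colourable V Adj j

IsClique : {N : ℕ} → (Fin N → Fin N → Set) → Subset N → Set
IsClique Adj Q = ∀ u v → u ∈ Q → v ∈ Q → u ≢ v → Adj u v

HasCliqueNumber : {N : ℕ} → (Fin N → Fin N → Set) → ℕ → Set
HasCliqueNumber {N} Adj w =
  (Σ (Subset N) λ Q → IsClique Adj Q × ∣ Q ∣ ≡ w) ×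
  (∀ Q → IsClique Adj Q → ∣ Q ∣ ≤ w)

LMinusV : (G : Multigraph) → Subset (m G) → Set
LMinusV G Q = Σ (Fin (m G)) λ e → e ∉ Q

LMinusAdj : (G : Multigraph) → (Q : Subset (m G)) → LMinusV G Q → LMinusV G Q → Set
LMinusAdj G Q (e , _) (f , _) = LAdj G e f

{-# OPTIONS --safe #-}

-- Put k = s + t − 2 and suppose that L(G) − Q is t-colourable for every clique Q of size s.
-- By greedy colouring some vertex x has degree at least s.  Given four edges at x, take an s-clique of the
-- star containing them and give its other edges private colours: G minus the four edges is (k − 2)-colourable.
-- Since stars and triangles have at most k edges, at least two colours are missing at x.  Two of the four
-- edges receive such colours, the other two receive new colours, and the edges thereby clashing at the far
-- ends move to the new colours.  This k-colours G unless the colouring forces k + 1 edges into a star or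
-- into a triangle, whatever the coincidences among the far ends (patterns abcd, aabc, aabb, aaab, aaaa).

module Submission where

open import Defs
open import Data.Nat using (ℕ; _+_; _∸_; _<_; _≤_)
open import Data.Fin using (Fin)
open import Data.Fin.Subset using (Subset; ∣_∣)
open import Data.Product using (Σ; ∃-syntax; _×_)
open import Relation.Binary.PropositionalEquality using (_≡_)

open import Data.Empty using (⊥; ⊥-elim)
open import Data.Nat using (zero; suc; z≤n; s≤s)
import Data.Nat.Properties as ℕ
open import Data.Fin using (zero; suc; punchIn; join; splitAt; inject≤; toℕ; fromℕ<)
open import Data.Fin.Properties using (_≟_; any?; all?; punchIn-injective; punchInᵢ≢i; splitAt-join; suc-injective; inject≤-injective; toℕ<n; toℕ-fromℕ<; toℕ-injective)
open import Data.Fin.Subset using (_∈_; _∉_; _⊆_; _∪_; _-_; ⁅_⁆; inside; outside) renaming (⊥ to ∅)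
open import Data.Fin.Subset.Properties using (_∈?_; anySubset?; x∈p⇒∣p-x∣<∣p∣; x∈p∧x≢y⇒x∈p-y; p⊆q⇒∣p∣≤∣q∣; ∪-identityʳ; x∈p∪q⁺; x∈p∪q⁻; x∈⁅y⁆⇒x≡y; ∉⊥; ∣⊥∣≡0)
open import Data.Product using (_,_; proj₁; proj₂; ∃)
open import Data.Sum using (_⊎_; inj₁; inj₂)
open import Data.Sum.Properties using (inj₁-injective; inj₂-injective)
open import Data.Vec using (Vec; []; _∷_; tabulate; lookup; here; there)
open import Data.Vec.Properties using (lookup∘tabulate; lookup⇒[]=; []=⇒lookup)
open import Function using (_∘_; id)
open import Relation.Binary.PropositionalEquality using (_≢_; refl; sym; trans; cong; subst; ≢-sym)
open import Relation.Nullary using (¬_; Dec; yes; no; does; contradiction)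
open import Relation.Nullary.Decidable using (_×-dec_; _⊎-dec_; _→-dec_; ¬?; map′; dec-true; decidable-stable)
open import Relation.Unary using (Decidable)

-- Counting in finite subsets

private variable
  N r : ℕ

subset : {P : Fin N → Set} → Decidable P → Subset N
subset P? = tabulate (does ∘ P?)

∈-subset⁺ : {P : Fin N → Set} (P? : Decidable P) {e : Fin N} → P e → e ∈ subset P?
∈-subset⁺ P? {e} p = lookup⇒[]= e _ (trans (lookup∘tabulate (does ∘ P?) e) (dec-true (P? e) p))

∈-subset⁻ : {P : Fin N → Set} (P? : Decidable P) {e : Fin N} → e ∈ subset P? → P e
∈-subset⁻ P? {e} e∈ with P? e | trans (sym (lookup∘tabulate (does ∘ P?) e)) ([]=⇒lookup e∈)
... | yes p | _ = p
... | no  _ | ()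

injection⇒≤ : (Q : Subset N) (h : Fin r → Fin N) → (∀ i j → h i ≡ h j → i ≡ j) → (∀ i → h i ∈ Q) → r ≤ ∣ Q ∣
injection⇒≤ {r = zero}  Q h inj h∈ = z≤n
injection⇒≤ {r = suc r} Q h inj h∈ = ℕ.≤-trans (s≤s (injection⇒≤ (Q - h zero) (h ∘ suc)
  (λ i j eq → suc-injective (inj (suc i) (suc j) eq))
  (λ i → x∈p∧x≢y⇒x∈p-y (h∈ (suc i)) (λ eq → contradiction (inj (suc i) zero eq) λ ()))))
  (x∈p⇒∣p-x∣<∣p∣ (h∈ zero))

≤⇒injection : (Q : Subset N) → r ≤ ∣ Q ∣ → Σ (Fin r → Fin N) λ h → (∀ i j → h i ≡ h j → i ≡ j) × (∀ i → h i ∈ Q)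
≤⇒injection {r = zero}  Q             _ = (λ ()) , (λ ()) , (λ ())
≤⇒injection {r = suc r} (outside ∷ Q) le with ≤⇒injection Q le
... | h , inj , h∈ = suc ∘ h , (λ i j eq → inj i j (suc-injective eq)) , there ∘ h∈
≤⇒injection {r = suc r} (inside ∷ Q) (s≤s le) with ≤⇒injection Q le
... | h , inj , h∈ =
  (λ { zero → zero ; (suc i) → suc (h i) }) ,
  (λ { zero zero _ → refl ; (suc i) (suc j) eq → cong suc (inj i j (suc-injective eq)) ; zero (suc _) () ; (suc _) zero () }) ,
  (λ { zero → here ; (suc i) → there (h∈ i) })

-- Edges picked for different colours are different, so `pick` itself injects the colours into `Q`.
colours⇒≤ : ∀ {k} (Q : Subset N) (c : Fin N → Fin k) → (∀ j → ∃[ e ] (e ∈ Q × c e ≡ j)) → k ≤ ∣ Q ∣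
colours⇒≤ Q c pick = injection⇒≤ Q (proj₁ ∘ pick)
  (λ i j eq → trans (sym (proj₂ (proj₂ (pick i)))) (trans (cong c eq) (proj₂ (proj₂ (pick j)))))
  (proj₁ ∘ proj₂ ∘ pick)

colours-but-one⇒≤ : ∀ {k} (Q : Subset N) (c : Fin N → Fin k) (j₀ : Fin k) →
  (∀ j → j ≢ j₀ → ∃[ e ] (e ∈ Q × c e ≡ j)) → k ≤ suc ∣ Q ∣
colours-but-one⇒≤ {k = suc k} Q c j₀ pick = s≤s (injection⇒≤ Q (proj₁ ∘ pick′)
  (λ i j eq → punchIn-injective j₀ i j
    (trans (sym (proj₂ (proj₂ (pick′ i)))) (trans (cong c eq) (proj₂ (proj₂ (pick′ j))))))
  (proj₁ ∘ proj₂ ∘ pick′))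
  where
  pick′ : ∀ i → ∃[ e ] (e ∈ Q × c e ≡ punchIn j₀ i)
  pick′ i = pick (punchIn j₀ i) (punchInᵢ≢i j₀ i)

∣p∪q∣≤∣p∣+∣q∣ : (p q : Subset N) → ∣ p ∪ q ∣ ≤ ∣ p ∣ + ∣ q ∣
∣p∪q∣≤∣p∣+∣q∣ []            []            = z≤n
∣p∪q∣≤∣p∣+∣q∣ (outside ∷ p) (outside ∷ q) = ∣p∪q∣≤∣p∣+∣q∣ p q
∣p∪q∣≤∣p∣+∣q∣ (outside ∷ p) (inside ∷ q)  =
  subst (suc ∣ p ∪ q ∣ ≤_) (sym (ℕ.+-suc ∣ p ∣ ∣ q ∣)) (s≤s (∣p∪q∣≤∣p∣+∣q∣ p q))
∣p∪q∣≤∣p∣+∣q∣ (inside ∷ p)  (outside ∷ q) = s≤s (∣p∪q∣≤∣p∣+∣q∣ p q)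
∣p∪q∣≤∣p∣+∣q∣ (inside ∷ p)  (inside ∷ q)  = s≤s (ℕ.≤-trans (∣p∪q∣≤∣p∣+∣q∣ p q) (ℕ.+-monoʳ-≤ ∣ p ∣ (ℕ.n≤1+n ∣ q ∣)))

∣p∪⁅x⁆∣≡1+∣p∣ : {p : Subset N} {x : Fin N} → x ∉ p → ∣ p ∪ ⁅ x ⁆ ∣ ≡ suc ∣ p ∣
∣p∪⁅x⁆∣≡1+∣p∣ {p = outside ∷ p} {zero}  x∉p = cong (suc ∘ ∣_∣) (∪-identityʳ p)
∣p∪⁅x⁆∣≡1+∣p∣ {p = inside ∷ p}  {zero}  x∉p = contradiction here x∉p
∣p∪⁅x⁆∣≡1+∣p∣ {p = outside ∷ p} {suc x} x∉p = ∣p∪⁅x⁆∣≡1+∣p∣ (x∉p ∘ there)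
∣p∪⁅x⁆∣≡1+∣p∣ {p = inside ∷ p}  {suc x} x∉p = cong suc (∣p∪⁅x⁆∣≡1+∣p∣ (x∉p ∘ there))

∉-∪-⁅⁆ : {p : Subset N} {x y : Fin N} → y ∉ p → y ≢ x → y ∉ p ∪ ⁅ x ⁆
∉-∪-⁅⁆ {p = p} {x} y∉p y≢x y∈ with x∈p∪q⁻ p ⁅ x ⁆ y∈
... | inj₁ y∈p = y∉p y∈p
... | inj₂ y∈x = y≢x (x∈⁅y⁆⇒x≡y x y∈x)

-- Written as vectors, the colourings of a finite edge set can be searched exhaustively; this is
-- what makes partial colourability decidable.
anyVec? : ∀ m {P : Vec (Fin N) m → Set} → Decidable P → Dec (∃ P)
anyVec? zero    P? = map′ (λ p → [] , p) (λ { ([] , p) → p }) (P? [])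
anyVec? (suc m) P? = map′ (λ { (i , v , p) → i ∷ v , p }) (λ { (i ∷ v , p) → i , v , p })
  (any? λ i → anyVec? m λ v → P? (i ∷ v))

-- Ends of edges, stars and triangles

module LineGraph (G : Multigraph) where

  E V : Set
  E = Fin (m G)
  V = Fin (n G)

  Inc : V → E → Set
  Inc = Incident G

  Inc? : ∀ v e → Dec (Inc v e)
  Inc? v e = (v ≟ src G e) ⊎-dec (v ≟ tgt G e)

  LAdj? : ∀ e f → Dec (LAdj G e f)
  LAdj? e f = ¬? (e ≟ f) ×-dec any? (λ v → Inc? v e ×-dec Inc? v f)

  LAdj-sym : ∀ {e f} → LAdj G e f → LAdj G f e
  LAdj-sym (e≢f , v , p , q) = e≢f ∘ sym , v , q , p

  -- Free of orientation: since `x ≢ y`, the two incidences use up both `src` and `tgt`, in either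
  -- order.
  Join : E → V → V → Set
  Join e x y = Inc x e × Inc y e × x ≢ y

  no-third-end : ∀ {e a b c} → Inc a e → Inc b e → Inc c e → a ≢ b → a ≢ c → b ≢ c → ⊥
  no-third-end (inj₁ refl) (inj₁ refl) _ a≢b _ _ = a≢b refl
  no-third-end (inj₂ refl) (inj₂ refl) _ a≢b _ _ = a≢b refl
  no-third-end (inj₁ refl) (inj₂ refl) (inj₁ refl) _ a≢c _ = a≢c refl
  no-third-end (inj₁ refl) (inj₂ refl) (inj₂ refl) _ _ b≢c = b≢c refl
  no-third-end (inj₂ refl) (inj₁ refl) (inj₁ refl) _ _ b≢c = b≢c refl
  no-third-end (inj₂ refl) (inj₁ refl) (inj₂ refl) _ a≢c _ = a≢c refl

  end-of : ∀ {e x y v} → Join e x y → Inc v e → v ≡ x ⊎ v ≡ y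
  end-of {x = x} {y} {v} (p , q , x≢y) i with v ≟ x | v ≟ y
  ... | yes eq | _      = inj₁ eq
  ... | no _   | yes eq = inj₂ eq
  ... | no a   | no b   = ⊥-elim (no-third-end i p q a b x≢y)

  other-end : ∀ {e x} → Inc x e → ∃[ y ] Join e x y
  other-end {e} (inj₁ refl) = tgt G e , inj₁ refl , inj₂ refl , loopless G e
  other-end {e} (inj₂ refl) = src G e , inj₂ refl , inj₁ refl , loopless G e ∘ sym

  ends≢⇒≢ : ∀ {e f x a b} → Join e x a → Join f x b → a ≢ b → e ≢ f
  ends≢⇒≢ (p , q , x≢a) (_ , s , x≢b) a≢b refl = no-third-end p q s x≢a x≢b a≢b

  star : V → Subset (m G)
  star x = subset (Inc? x)

  star-clique : ∀ x {Q} → Q ⊆ star x → IsClique (LAdj G) Q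
  star-clique x Q⊆ e f e∈ f∈ e≢f = e≢f , x , ∈-subset⁻ (Inc? x) (Q⊆ e∈) , ∈-subset⁻ (Inc? x) (Q⊆ f∈)

  -- All parallel edges are included. Besides the star, this triangle with multiplicities is the
  -- other clique to which the clique bound is applied.
  InTriangle : V → V → V → E → Set
  InTriangle x a b e = Join e x a ⊎ Join e x b ⊎ Join e a b

  Join? : ∀ e x y → Dec (Join e x y)
  Join? e x y = Inc? x e ×-dec Inc? y e ×-dec ¬? (x ≟ y)

  InTriangle? : ∀ x a b e → Dec (InTriangle x a b e)
  InTriangle? x a b e = Join? e x a ⊎-dec Join? e x b ⊎-dec Join? e a b

  triangle : V → V → V → Subset (m G)
  triangle x a b = subset (InTriangle? x a b)

  triangle-clique : ∀ x a b → IsClique (LAdj G) (triangle x a b)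
  triangle-clique x a b e f e∈ f∈ e≢f = e≢f , meet (∈-subset⁻ (InTriangle? x a b) e∈) (∈-subset⁻ (InTriangle? x a b) f∈)
    where
    meet : InTriangle x a b e → InTriangle x a b f → ∃[ v ] (Inc v e × Inc v f)
    meet (inj₁ (p , _))               (inj₁ (q , _))               = x , p , q
    meet (inj₁ (p , _))               (inj₂ (inj₁ (q , _)))        = x , p , q
    meet (inj₁ (_ , p , _))           (inj₂ (inj₂ (q , _)))        = a , p , q
    meet (inj₂ (inj₁ (p , _)))        (inj₁ (q , _))               = x , p , q
    meet (inj₂ (inj₁ (p , _)))        (inj₂ (inj₁ (q , _)))        = x , p , q
    meet (inj₂ (inj₁ (_ , p , _)))    (inj₂ (inj₂ (_ , q , _)))    = b , p , q
    meet (inj₂ (inj₂ (p , _)))        (inj₁ (_ , q , _))           = a , p , q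
    meet (inj₂ (inj₂ (_ , p , _)))    (inj₂ (inj₁ (_ , q , _)))    = b , p , q
    meet (inj₂ (inj₂ (p , _)))        (inj₂ (inj₂ (q , _)))        = a , p , q

  -- Partial edge colourings

  Proper : (E → Set) → (E → Fin N) → Set
  Proper P c = ∀ e f → P e → P f → LAdj G e f → c e ≢ c f

  -- The function is total, with arbitrary values off `P`; hence restricting to fewer edges keeps
  -- the same function.
  PartialColouring : (E → Set) → ℕ → Set
  PartialColouring P N = Σ (E → Fin N) (Proper P)

  same-colour⇒≡ : ∀ {P} {c : E → Fin N} {e f v} → Proper P c → P e → P f → Inc v e → Inc v f → c e ≡ c f → e ≡ f
  same-colour⇒≡ {e = e} {f} {v} proper Pe Pf ie if eq with e ≟ f
  ... | yes e≡f = e≡f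
  ... | no  e≢f = contradiction eq (proper e f Pe Pf (e≢f , v , ie , if))

  partialColouring? : (Q : Subset (m G)) (N : ℕ) → Dec (PartialColouring (_∉ Q) N)
  partialColouring? Q N = map′
    (λ { (v , p) → lookup v , p })
    (λ { (c , p) → tabulate c , λ e f e∉ f∉ adj eq →
         p e f e∉ f∉ adj (trans (sym (lookup∘tabulate c e)) (trans eq (lookup∘tabulate c f))) })
    (anyVec? (m G) λ v → all? λ e → all? λ f →
      ¬? (e ∈? Q) →-dec (¬? (f ∈? Q) →-dec (LAdj? e f →-dec ¬? (lookup v e ≟ lookup v f))))

  isClique? : (Q : Subset (m G)) → Dec (IsClique (LAdj G) Q)
  isClique? Q = all? λ e → all? λ f → (e ∈? Q) →-dec ((f ∈? Q) →-dec (¬? (e ≟ f) →-dec LAdj? e f))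

  -- Each edge of Q ∖ A receives a colour of its own.
  extend-within : ∀ r (A S : Subset (m G)) → A ⊆ S → r + ∣ A ∣ ≤ ∣ S ∣ →
    Σ (Subset (m G)) λ Q → Q ⊆ S × ∣ Q ∣ ≡ r + ∣ A ∣ ×
      (∀ {t} → PartialColouring (_∉ Q) t → PartialColouring (_∉ A) (r + t))
  extend-within zero    A S A⊆S _ = A , A⊆S , refl , id
  extend-within (suc r) A S A⊆S le with any? (λ e → (e ∈? S) ×-dec ¬? (e ∈? A))
  ... | no none = contradiction (ℕ.≤-trans le (p⊆q⇒∣p∣≤∣q∣ S⊆A)) (ℕ.<⇒≱ (s≤s (ℕ.m≤n+m ∣ A ∣ r)))
    where
    S⊆A : S ⊆ A
    S⊆A {e} e∈S = decidable-stable (e ∈? A) λ e∉A → none (e , e∈S , e∉A)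
  ... | yes (e , e∈S , e∉A) with extend-within r (A ∪ ⁅ e ⁆) S A'⊆S (subst (_≤ ∣ S ∣) size le)
    where
    A'⊆S : A ∪ ⁅ e ⁆ ⊆ S
    A'⊆S f∈ with x∈p∪q⁻ A ⁅ e ⁆ f∈
    ... | inj₁ f∈A = A⊆S f∈A
    ... | inj₂ f∈e with x∈⁅y⁆⇒x≡y e f∈e
    ... | refl = e∈S
    size : suc (r + ∣ A ∣) ≡ r + ∣ A ∪ ⁅ e ⁆ ∣
    size = trans (sym (ℕ.+-suc r ∣ A ∣)) (cong (r +_) (sym (∣p∪⁅x⁆∣≡1+∣p∣ e∉A)))
  ... | Q , Q⊆S , ∣Q∣≡ , colour = Q , Q⊆S ,
        trans ∣Q∣≡ (trans (cong (r +_) (∣p∪⁅x⁆∣≡1+∣p∣ e∉A)) (ℕ.+-suc r ∣ A ∣)) , λ pc → fresh (colour pc)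
    where
    fresh : ∀ {t} → PartialColouring (_∉ (A ∪ ⁅ e ⁆)) t → PartialColouring (_∉ A) (suc t)
    fresh {t} (c , proper) = c′ , proper′
      where
      c′ : E → Fin (suc t)
      c′ f with f ≟ e
      ... | yes _ = zero
      ... | no  _ = suc (c f)
      proper′ : Proper (_∉ A) c′
      proper′ f g f∉ g∉ adj with f ≟ e | g ≟ e
      ... | yes refl | yes refl = contradiction refl (proj₁ adj)
      ... | yes _    | no _     = λ ()
      ... | no _     | yes _    = λ ()
      ... | no f≢e   | no g≢e   = proper f g (∉-∪-⁅⁆ f∉ f≢e) (∉-∪-⁅⁆ g∉ g≢e) adj ∘ suc-injective

  -- Edges are coloured in the order of their indices. An edge and its neighbours lie in the union
  -- of two stars, which has at most `d + d` edges; as the edge itself is one of them, its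
  -- neighbours cannot use all `k` colours.
  greedy : ∀ {k d} → (∀ x → ∣ star x ∣ ≤ d) → d + d ≤ k → Colourable E (LAdj G) k
  greedy {k} {d} small d+d≤k with upTo (m G) ℕ.≤-refl
    where
    upTo : ∀ i → i ≤ m G → PartialColouring (λ e → toℕ e < i) k
    upTo zero    _  = first , λ _ _ ()
      where
      first : E → Fin k
      -- A default colour exists as soon as there is an edge: its star is nonempty, so `1 ≤ d ≤ k`.
      first e = inject≤ {n = k} zero (ℕ.≤-trans (ℕ.≤-trans positive (small (src G e))) (ℕ.≤-trans (ℕ.m≤m+n d d) d+d≤k))
        where
        positive : 1 ≤ ∣ star (src G e) ∣
        positive = ℕ.≤-trans (s≤s z≤n) (x∈p⇒∣p-x∣<∣p∣ (∈-subset⁺ (Inc? (src G e)) {e} (inj₁ refl)))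
    upTo (suc i) i<m with upTo i (ℕ.<⇒≤ i<m)
    -- All neighbours are avoided, also those that still carry the default value; the degree bound
    -- covers them too.
    ... | c , proper with any? (λ α → all? λ f → LAdj? (fromℕ< i<m) f →-dec ¬? (c f ≟ α))
    ... | yes (α , free) = c′ , proper′
      where
      e : E
      e = fromℕ< i<m
      c′ : E → Fin k
      c′ f with f ≟ e
      ... | yes _ = α
      ... | no  _ = c f
      earlier : ∀ {f} → toℕ f < suc i → f ≢ e → toℕ f < i
      earlier {f} (s≤s f≤i) f≢e = ℕ.≤∧≢⇒< f≤i λ eq → f≢e (toℕ-injective (trans eq (sym (toℕ-fromℕ< i<m))))
      proper′ : Proper (λ f → toℕ f < suc i) c′
      proper′ f g f< g< adj with f ≟ e | g ≟ e
      ... | yes refl | yes refl = contradiction refl (proj₁ adj)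
      ... | yes refl | no _     = free g adj ∘ sym
      ... | no _     | yes refl = free f (LAdj-sym adj)
      ... | no f≢e   | no g≢e   = proper f g (earlier f< f≢e) (earlier g< g≢e) adj
    ... | no blocked = contradiction (ℕ.≤-trans (s≤s k≤) (x∈p⇒∣p-x∣<∣p∣ e∈)) (ℕ.≤⇒≯ (ℕ.≤-trans ∣B∣≤ d+d≤k))
      where
      e : E
      e = fromℕ< i<m
      B : Subset (m G)
      B = star (src G e) ∪ star (tgt G e)
      e∈ : e ∈ B
      e∈ = x∈p∪q⁺ (inj₁ (∈-subset⁺ (Inc? (src G e)) (inj₁ refl)))
      ∣B∣≤ : ∣ B ∣ ≤ d + d
      ∣B∣≤ = ℕ.≤-trans (∣p∪q∣≤∣p∣+∣q∣ (star (src G e)) (star (tgt G e))) (ℕ.+-mono-≤ (small (src G e)) (small (tgt G e)))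
      pick : ∀ α → ∃[ f ] (LAdj G e f × c f ≡ α)
      pick α with any? (λ f → LAdj? e f ×-dec (c f ≟ α))
      ... | yes found = found
      ... | no none = contradiction (α , λ f adj eq → none (f , adj , eq)) blocked
      pick∈ : ∀ α → ∃[ f ] (f ∈ B - e × c f ≡ α)
      pick∈ α with pick α
      ... | f , (e≢f , v , inj₁ refl , q) , cf =
        f , x∈p∧x≢y⇒x∈p-y (x∈p∪q⁺ (inj₁ (∈-subset⁺ (Inc? (src G e)) q))) (e≢f ∘ sym) , cf
      ... | f , (e≢f , v , inj₂ refl , q) , cf =
        f , x∈p∧x≢y⇒x∈p-y (x∈p∪q⁺ {p = star (src G e)} (inj₂ (∈-subset⁺ (Inc? (tgt G e)) q))) (e≢f ∘ sym) , cf
      k≤ : k ≤ ∣ B - e ∣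
      k≤ = colours⇒≤ (B - e) c pick∈
  ... | c , proper = c , λ e f adj → proper e f (toℕ<n e) (toℕ<n f) adj


  -- Recolouring around a vertex with two new colours

  module Recolouring (N : ℕ) (uncolourable : ¬ Colourable E (LAdj G) (2 + N)) where

    -- The edges b₀, b₁, u₀, u₁, … at x are the uncoloured ones.  The bᵢ get the two new colours and uᵢ
    -- gets the old colour γᵢ, missing at x; a γᵢ-edge at the other end of uᵢ is moved to the new colour ρᵢ.
    module Move {P : E → Set} {c : E → Fin N} (proper : Proper P c) (x : V) {q : ℕ}
      (b : Fin 2 → E) (z : Fin 2 → V) (u : Fin q → E) (y : Fin q → V) (γ : Fin q → Fin N) (ρ : Fin q → Fin 2) where

      Rest : E → Set
      Rest e = (∀ i → b i ≢ e) × (∀ i → u i ≢ e)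

      Clash : Fin q → E → Set
      Clash i e = c e ≡ γ i × Inc (y i) e

      -- The new colouring is given as a relation that records why an edge gets its colour, so that
      -- properness becomes a case analysis on two such reasons.
      data NewColour (e : E) : Fin 2 ⊎ Fin N → Set where
        new   : ∀ i → b i ≡ e → NewColour e (inj₁ i)
        old   : ∀ i → u i ≡ e → NewColour e (inj₂ (γ i))
        moved : ∀ i → Rest e → Clash i e → NewColour e (inj₁ (ρ i))
        kept  : Rest e → (∀ i → ¬ Clash i e) → NewColour e (inj₂ (c e))

      newColour : ∀ e → ∃ (NewColour e)
      newColour e with any? (λ i → b i ≟ e)
      ... | yes (i , eq) = _ , new i eq
      ... | no ∉b with any? (λ i → u i ≟ e)
      ... | yes (i , eq) = _ , old i eq
      ... | no ∉u with any? (λ i → (c e ≟ γ i) ×-dec Inc? (y i) e)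
      ... | yes (i , clash) = _ , moved i ((λ j eq → ∉b (j , eq)) , (λ j eq → ∉u (j , eq))) clash
      ... | no free = _ , kept ((λ j eq → ∉b (j , eq)) , (λ j eq → ∉u (j , eq))) (λ j clash → free (j , clash))

      -- The new colouring would be proper. `free` protects the `u i` at `x` and keeps moved edges
      -- away from `x`; `avoid` keeps a moved edge off the far end of the `b`-edge whose new colour
      -- it shares; `apart` separates edges moved to one new colour for different indices. Edges
      -- moved for the same index had equal old colours, so they were not adjacent.
      impossible : (∀ i → Join (b i) x (z i)) → (∀ i → Join (u i) x (y i)) →
        (∀ e → Rest e → P e) →
        (∀ i j → γ i ≡ γ j → i ≡ j) →
        (∀ i e → Rest e → Inc x e → c e ≢ γ i) →
        (∀ i e → Rest e → Clash i e → ¬ Inc (z (ρ i)) e) →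
        (∀ i j e f → i ≢ j → ρ i ≡ ρ j → Rest e → Rest f → Clash i e → Clash j f → ∀ v → Inc v e → ¬ Inc v f) →
        ⊥
      impossible bz uy cover γ-inj free avoid apart = uncolourable
        (join 2 N ∘ proj₁ ∘ newColour , λ e f adj eq → distinct adj (proj₂ (newColour e)) (proj₂ (newColour f))
          (trans (sym (splitAt-join 2 N _)) (trans (cong (splitAt 2) eq) (splitAt-join 2 N _))))
        where
        new≢moved : ∀ {e f i j} → LAdj G e f → b i ≡ e → Rest f → Clash j f → i ≢ ρ j
        new≢moved {f = f} {j = j} (_ , v , p , r) refl R (cf , yf) refl with end-of (bz (ρ j)) p
        ... | inj₁ refl = free j f R r cf
        ... | inj₂ refl = avoid j f R (cf , yf) r

        old≢kept : ∀ {e f i} → LAdj G e f → u i ≡ e → Rest f → (∀ j → ¬ Clash j f) → γ i ≢ c f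
        old≢kept {f = f} {i} (_ , v , p , r) refl R ok eq with end-of (uy i) p
        ... | inj₁ refl = free i f R r (sym eq)
        ... | inj₂ refl = ok i (sym eq , r)

        distinct : ∀ {e f k l} → LAdj G e f → NewColour e k → NewColour f l → k ≢ l
        distinct (e≢f , _) (new i refl) (new j refl) eq = e≢f (cong b (inj₁-injective eq))
        distinct adj (new i eq) (moved j R cl) = new≢moved adj eq R cl ∘ inj₁-injective
        distinct adj (moved j R cl) (new i eq) = new≢moved (LAdj-sym adj) eq R cl ∘ sym ∘ inj₁-injective
        distinct {e} {f} adj@(_ , v , p , r) (moved i R cl) (moved j R′ cl′) eq with i ≟ j
        ... | yes refl = proper e f (cover e R) (cover f R′) adj (trans (proj₁ cl) (sym (proj₁ cl′)))
        ... | no i≢j = apart i j e f i≢j (inj₁-injective eq) R R′ cl cl′ v p r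
        distinct (e≢f , _) (old i refl) (old j refl) eq = e≢f (cong u (γ-inj i j (inj₂-injective eq)))
        distinct adj (old i eq) (kept R ok) = old≢kept adj eq R ok ∘ inj₂-injective
        distinct adj (kept R ok) (old i eq) = old≢kept (LAdj-sym adj) eq R ok ∘ sym ∘ inj₂-injective
        distinct {e} {f} adj (kept R _) (kept R′ _) = proper e f (cover e R) (cover f R′) adj ∘ inj₂-injective
        distinct _ (new _ _) (old _ _) ()
        distinct _ (new _ _) (kept _ _) ()
        distinct _ (moved _ _ _) (old _ _) ()
        distinct _ (moved _ _ _) (kept _ _) ()
        distinct _ (old _ _) (new _ _) ()
        distinct _ (old _ _) (moved _ _ _) ()
        distinct _ (kept _ _) (new _ _) ()
        distinct _ (kept _ _) (moved _ _ _) ()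

    Missing : (E → Set) → (E → Fin N) → V → Fin N → Set
    Missing P c v α = ∀ e → P e → Inc v e → c e ≢ α

    -- The obstruction to a move: an `α`-edge at `a` that takes the new colour of an edge from `x`
    -- to `b` conflicts with it by ending at `b` too. With `a` and `b` equal, it says that `α`
    -- occurs at `a`.
    Between : (E → Set) → (E → Fin N) → V → V → Fin N → Set
    Between P c a b α = ∃[ e ] (P e × c e ≡ α × Inc a e × Inc b e)

    Between-swap : ∀ {P c a b α} → Between P c a b α → Between P c b a α
    Between-swap (e , Pe , ce , ae , be) = e , Pe , ce , be , ae

    -- A vertex has at most one `α`-edge, and that edge has only one other end. Thus an edge that
    -- blocks one recolouring cannot block the alternative one.
    Between-functional : ∀ {P c v a b α} → Proper P c → v ≢ a → v ≢ b → a ≢ b → Between P c v a α → ¬ Between P c v b α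
    Between-functional proper v≢a v≢b a≢b (e , Pe , ce , ve , ae) (f , Pf , cf , vf , bf)
      with same-colour⇒≡ proper Pe Pf ve vf (trans ce (sym cf))
    ... | refl = no-third-end ve ae bf v≢a v≢b a≢b

    module _ {P : E → Set} {c : E → Fin N} (proper : Proper P c) where

      -- `e₁`, `e₂` take `α₁`, `α₂` and `e₃`, `e₄` take the new colours. The `α₁`-edge at `y₁` joins
      -- the new colour of `e₃`, the `α₂`-edge at `y₂` that of `e₄`.
      recolour₂ : ∀ {x e₁ e₂ e₃ e₄ y₁ y₂ y₃ y₄ α₁ α₂} →
        Join e₁ x y₁ → Join e₂ x y₂ → Join e₃ x y₃ → Join e₄ x y₄ →
        (∀ e → e ≢ e₁ → e ≢ e₂ → e ≢ e₃ → e ≢ e₄ → P e) →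
        α₁ ≢ α₂ → Missing P c x α₁ → Missing P c x α₂ →
        ¬ Between P c y₁ y₃ α₁ → ¬ Between P c y₂ y₄ α₂ → ⊥
      recolour₂ {x} {e₁} {e₂} {e₃} {e₄} {y₁} {y₂} {y₃} {y₄} {α₁} {α₂} j₁ j₂ j₃ j₄ cover α₁≢α₂ miss₁ miss₂ ok₁ ok₂ =
        impossible
          (λ { zero → j₃ ; (suc zero) → j₄ })
          (λ { zero → j₁ ; (suc zero) → j₂ })
          cover′
          (λ { zero zero _ → refl ; zero (suc zero) eq → contradiction eq α₁≢α₂
             ; (suc zero) zero eq → contradiction (sym eq) α₁≢α₂ ; (suc zero) (suc zero) _ → refl })
          (λ { zero e R → miss₁ e (cover′ e R) ; (suc zero) e R → miss₂ e (cover′ e R) })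
          (λ { zero e R (p , q) r → ok₁ (e , cover′ e R , p , q , r)
             ; (suc zero) e R (p , q) r → ok₂ (e , cover′ e R , p , q , r) })
          -- The displaced edges go to different new colours, so they may share an end.
          (λ i j e f i≢j eq → contradiction eq i≢j)
        where
        open Move proper x (lookup (e₃ ∷ e₄ ∷ [])) (lookup (y₃ ∷ y₄ ∷ []))
          (lookup (e₁ ∷ e₂ ∷ [])) (lookup (y₁ ∷ y₂ ∷ [])) (lookup (α₁ ∷ α₂ ∷ [])) id
        cover′ : ∀ e → Rest e → P e
        cover′ e (∉b , ∉u) = cover e (∉u zero ∘ sym) (∉u (suc zero) ∘ sym) (∉b zero ∘ sym) (∉b (suc zero) ∘ sym)

      -- Here e₁ was coloured γ; it takes over α₁ so that e₀ can have γ.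
      recolour₃ : ∀ {x e₀ e₁ e₂ e₃ e₄ y₀ y₁ y₂ y₃ y₄ γ α₁ α₂} →
        Join e₀ x y₀ → Join e₁ x y₁ → Join e₂ x y₂ → Join e₃ x y₃ → Join e₄ x y₄ →
        (∀ e → e ≢ e₀ → e ≢ e₂ → e ≢ e₃ → e ≢ e₄ → P e) →
        P e₁ → c e₁ ≡ γ →
        α₁ ≢ α₂ → Missing P c x α₁ → Missing P c x α₂ →
        ¬ Between P c y₀ y₄ γ → ¬ Between P c y₁ y₄ α₁ → ¬ Between P c y₂ y₃ α₂ →
        (∀ h g v → P h → P g → c h ≡ γ → Inc y₀ h → c g ≡ α₁ → Inc y₁ g → Inc v h → ¬ Inc v g) → ⊥
      recolour₃ {x} {e₀} {e₁} {e₂} {e₃} {e₄} {y₀} {y₁} {y₂} {y₃} {y₄} {γ} {α₁} {α₂}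
        j₀ j₁ j₂ j₃ j₄ cover Pe₁ ce₁ α₁≢α₂ miss₁ miss₂ ok₀ ok₁ ok₂ far =
        impossible
          (λ { zero → j₃ ; (suc zero) → j₄ })
          (λ { zero → j₀ ; (suc zero) → j₁ ; (suc (suc zero)) → j₂ })
          cover′
          (λ { zero zero _ → refl ; zero (suc zero) eq → contradiction eq γ≢α₁ ; zero (suc (suc zero)) eq → contradiction eq γ≢α₂
             ; (suc zero) zero eq → contradiction (sym eq) γ≢α₁ ; (suc zero) (suc zero) _ → refl
             ; (suc zero) (suc (suc zero)) eq → contradiction eq α₁≢α₂
             ; (suc (suc zero)) zero eq → contradiction (sym eq) γ≢α₂
             ; (suc (suc zero)) (suc zero) eq → contradiction (sym eq) α₁≢α₂ ; (suc (suc zero)) (suc (suc zero)) _ → refl })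
          (λ { zero e R xe ce → proj₂ R (suc zero)
                 (same-colour⇒≡ proper Pe₁ (cover′ e R) (proj₁ j₁) xe (trans ce₁ (sym ce)))
             ; (suc zero) e R → miss₁ e (cover′ e R) ; (suc (suc zero)) e R → miss₂ e (cover′ e R) })
          (λ { zero e R (p , q) r → ok₀ (e , cover′ e R , p , q , r)
             ; (suc zero) e R (p , q) r → ok₁ (e , cover′ e R , p , q , r)
             ; (suc (suc zero)) e R (p , q) r → ok₂ (e , cover′ e R , p , q , r) })
          (λ { zero zero e f i≢j _ → contradiction refl i≢j
             ; zero (suc zero) e f _ _ R R′ (p , q) (p′ , q′) v → far e f v (cover′ e R) (cover′ f R′) p q p′ q′
             ; (suc zero) zero e f _ _ R R′ (p , q) (p′ , q′) v r r′ → far f e v (cover′ f R′) (cover′ e R) p′ q′ p q r′ r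
             ; (suc zero) (suc zero) e f i≢j _ → contradiction refl i≢j
             ; (suc (suc zero)) (suc (suc zero)) e f i≢j _ → contradiction refl i≢j
             ; zero (suc (suc zero)) e f _ () ; (suc zero) (suc (suc zero)) e f _ ()
             ; (suc (suc zero)) zero e f _ () ; (suc (suc zero)) (suc zero) e f _ () })
        where
        -- The `γ`-edge at `y₀` and the `α₁`-edge at `y₁` both go to the new colour of `e₄`, whence
        -- `far`; the `α₂`-edge at `y₂` goes to that of `e₃`.
        open Move proper x (lookup (e₃ ∷ e₄ ∷ [])) (lookup (y₃ ∷ y₄ ∷ []))
          (lookup (e₀ ∷ e₁ ∷ e₂ ∷ [])) (lookup (y₀ ∷ y₁ ∷ y₂ ∷ [])) (lookup (γ ∷ α₁ ∷ α₂ ∷ []))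
          (lookup (suc zero ∷ suc zero ∷ zero ∷ []))
        cover′ : ∀ e → Rest e → P e
        cover′ e (∉b , ∉u) = cover e (∉u zero ∘ sym) (∉u (suc (suc zero)) ∘ sym) (∉b zero ∘ sym) (∉b (suc zero) ∘ sym)
        γ≢α₁ : γ ≢ α₁
        γ≢α₁ refl = miss₁ e₁ Pe₁ (proj₁ j₁) ce₁
        γ≢α₂ : γ ≢ α₂
        γ≢α₂ refl = miss₂ e₁ Pe₁ (proj₁ j₁) ce₁

    Distinct : E → E → E → E → Set
    Distinct q₁ q₂ q₃ q₄ = q₁ ≢ q₂ × q₁ ≢ q₃ × q₁ ≢ q₄ × q₂ ≢ q₃ × q₂ ≢ q₄ × q₃ ≢ q₄

    Off : E → E → E → E → E → Set
    Off q₁ q₂ q₃ q₄ e = e ≢ q₁ × e ≢ q₂ × e ≢ q₃ × e ≢ q₄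

    Off? : ∀ q₁ q₂ q₃ q₄ e → Dec (Off q₁ q₂ q₃ q₄ e)
    Off? q₁ q₂ q₃ q₄ e = ¬? (e ≟ q₁) ×-dec ¬? (e ≟ q₂) ×-dec ¬? (e ≟ q₃) ×-dec ¬? (e ≟ q₄)

    module CliqueBound (bound : ∀ Q → IsClique (LAdj G) Q → ∣ Q ∣ ≤ 2 + N) where

      Unused : (E → Set) → (E → Fin N) → Subset (m G) → Fin N → Set
      Unused P c Q j = ∀ e → P e → e ∈ Q → c e ≢ j

      module _ {q₁ q₂ q₃ q₄ : E} (c : E → Fin N) (Q : Subset (m G)) (clique : IsClique (LAdj G) Q) where

        private
          P : E → Set
          P = Off q₁ q₂ q₃ q₄

          used? : ∀ j → Dec (∃[ e ] (P e × e ∈ Q × c e ≡ j))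
          used? j = any? λ e → Off? q₁ q₂ q₃ q₄ e ×-dec (e ∈? Q) ×-dec (c e ≟ j)

        -- If all `N` colours occurred on `Q`, one edge of each together with the three uncoloured
        -- ones would give `3 + N` edges, one more than `bound` allows.
        unused-colour : q₁ ≢ q₂ → q₁ ≢ q₃ → q₂ ≢ q₃ → q₁ ∈ Q → q₂ ∈ Q → q₃ ∈ Q →
          (∀ j → Unused P c Q j → ⊥) → ⊥
        unused-colour d₁₂ d₁₃ d₂₃ q₁∈ q₂∈ q₃∈ none = ℕ.<⇒≱ big (bound Q clique)
          where
          pick : ∀ j → ∃[ e ] (e ∈ Q - q₁ - q₂ - q₃ × c e ≡ j)
          pick j with used? j
          ... | yes (e , (n₁ , n₂ , n₃ , _) , e∈ , ce) =
            e , x∈p∧x≢y⇒x∈p-y (x∈p∧x≢y⇒x∈p-y (x∈p∧x≢y⇒x∈p-y e∈ n₁) n₂) n₃ , ce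
          ... | no unused = ⊥-elim (none j λ e Pe e∈ ce → unused (e , Pe , e∈ , ce))
          q₂∈′ : q₂ ∈ Q - q₁
          q₂∈′ = x∈p∧x≢y⇒x∈p-y q₂∈ (≢-sym d₁₂)
          q₃∈′ : q₃ ∈ Q - q₁ - q₂
          q₃∈′ = x∈p∧x≢y⇒x∈p-y (x∈p∧x≢y⇒x∈p-y q₃∈ (≢-sym d₁₃)) (≢-sym d₂₃)
          big : 3 + N ≤ ∣ Q ∣
          big = ℕ.≤-trans (s≤s (ℕ.≤-trans (s≤s (ℕ.≤-trans (s≤s (colours⇒≤ _ c pick))
            (x∈p⇒∣p-x∣<∣p∣ q₃∈′))) (x∈p⇒∣p-x∣<∣p∣ q₂∈′))) (x∈p⇒∣p-x∣<∣p∣ q₁∈)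

        two-unused-colours : Distinct q₁ q₂ q₃ q₄ → q₁ ∈ Q → q₂ ∈ Q → q₃ ∈ Q → q₄ ∈ Q →
          (∀ i j → i ≢ j → Unused P c Q i → Unused P c Q j → ⊥) → ⊥
        two-unused-colours (d₁₂ , d₁₃ , d₁₄ , d₂₃ , d₂₄ , d₃₄) q₁∈ q₂∈ q₃∈ q₄∈ none =
          unused-colour d₁₂ d₁₃ d₂₃ q₁∈ q₂∈ q₃∈ λ i unusedᵢ → ℕ.<⇒≱ (big i unusedᵢ) (bound Q clique)
          where
          q₂∈′ : q₂ ∈ Q - q₁
          q₂∈′ = x∈p∧x≢y⇒x∈p-y q₂∈ (≢-sym d₁₂)
          q₃∈′ : q₃ ∈ Q - q₁ - q₂
          q₃∈′ = x∈p∧x≢y⇒x∈p-y (x∈p∧x≢y⇒x∈p-y q₃∈ (≢-sym d₁₃)) (≢-sym d₂₃)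
          q₄∈′ : q₄ ∈ Q - q₁ - q₂ - q₃
          q₄∈′ = x∈p∧x≢y⇒x∈p-y (x∈p∧x≢y⇒x∈p-y (x∈p∧x≢y⇒x∈p-y q₄∈ (≢-sym d₁₄)) (≢-sym d₂₄)) (≢-sym d₃₄)
          module _ (i : Fin N) (unusedᵢ : Unused P c Q i) where
            pick : ∀ j → j ≢ i → ∃[ e ] (e ∈ Q - q₁ - q₂ - q₃ - q₄ × c e ≡ j)
            pick j j≢i with used? j
            ... | yes (e , (n₁ , n₂ , n₃ , n₄) , e∈ , ce) =
              e , x∈p∧x≢y⇒x∈p-y (x∈p∧x≢y⇒x∈p-y (x∈p∧x≢y⇒x∈p-y (x∈p∧x≢y⇒x∈p-y e∈ n₁) n₂) n₃) n₄ , ce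
            ... | no unused = ⊥-elim (none i j (≢-sym j≢i) unusedᵢ λ e Pe e∈ ce → unused (e , Pe , e∈ , ce))
            big : 3 + N ≤ ∣ Q ∣
            big = ℕ.≤-trans (s≤s (ℕ.≤-trans (s≤s (ℕ.≤-trans (s≤s (ℕ.≤-trans (colours-but-one⇒≤ _ c i pick)
              (x∈p⇒∣p-x∣<∣p∣ q₄∈′))) (x∈p⇒∣p-x∣<∣p∣ q₃∈′))) (x∈p⇒∣p-x∣<∣p∣ q₂∈′))) (x∈p⇒∣p-x∣<∣p∣ q₁∈)

      -- Four edges at a vertex, by the coincidences among their far ends

      module AtVertex (x : V)
        (colour-off : ∀ {q₁ q₂ q₃ q₄} → Distinct q₁ q₂ q₃ q₄ → Inc x q₁ → Inc x q₂ → Inc x q₃ → Inc x q₄ →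
          ¬ ¬ PartialColouring (Off q₁ q₂ q₃ q₄) N) where

        two-missing-colours : ∀ {q₁ q₂ q₃ q₄} (c : E → Fin N) (v : V) → Distinct q₁ q₂ q₃ q₄ →
          Inc v q₁ → Inc v q₂ → Inc v q₃ → Inc v q₄ →
          (∀ α β → α ≢ β → Missing (Off q₁ q₂ q₃ q₄) c v α → Missing (Off q₁ q₂ q₃ q₄) c v β → ⊥) → ⊥
        two-missing-colours c v d i₁ i₂ i₃ i₄ k = two-unused-colours c (star v) (star-clique v id) d
          (∈-subset⁺ (Inc? v) i₁) (∈-subset⁺ (Inc? v) i₂) (∈-subset⁺ (Inc? v) i₃) (∈-subset⁺ (Inc? v) i₄)
          λ α β α≢β u₁ u₂ → k α β α≢β (λ e Pe i → u₁ e Pe (∈-subset⁺ (Inc? v) i)) (λ e Pe i → u₂ e Pe (∈-subset⁺ (Inc? v) i))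

        -- Let `q₁` take `α`. The `α`-edge at `a` ends in at most one of `b`, `c`, `d`; the edge to
        -- that end is chosen to take `β`, so `α` is not blocked. The `β`-edge at the chosen end
        -- cannot reach both remaining ends, so one of the two orders of the new colours works.
        ends-abcd : ∀ {q₁ q₂ q₃ q₄ a b c d} → Join q₁ x a → Join q₂ x b → Join q₃ x c → Join q₄ x d →
          a ≢ b → a ≢ c → a ≢ d → b ≢ c → b ≢ d → c ≢ d → ⊥
        ends-abcd {q₁} {q₂} {q₃} {q₄} {a} {b} {c} {d} j₁ j₂ j₃ j₄ a≢b a≢c a≢d b≢c b≢d c≢d =
          colour-off distinct (proj₁ j₁) (proj₁ j₂) (proj₁ j₃) (proj₁ j₄) λ (φ , proper) →
          two-missing-colours φ x distinct (proj₁ j₁) (proj₁ j₂) (proj₁ j₃) (proj₁ j₄) λ α β α≢β missα missβ →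
          let
            -- q₁ gets α and p gets β.
            partner : ∀ {p q r y v w} → Join p x y → Join q x v → Join r x w →
              (∀ e → e ≢ q₁ → e ≢ p → e ≢ q → e ≢ r → Off q₁ q₂ q₃ q₄ e) → y ≢ v → y ≢ w → v ≢ w →
              ¬ Between (Off q₁ q₂ q₃ q₄) φ a v α → ¬ Between (Off q₁ q₂ q₃ q₄) φ a w α → ⊥
            partner jp jq jr cover y≢v y≢w v≢w ¬av ¬aw =
              recolour₂ proper j₁ jp jq jr cover α≢β missα missβ ¬av λ yw →
              recolour₂ proper j₁ jp jr jq (λ e n₁ n₂ n₃ n₄ → cover e n₁ n₂ n₄ n₃) α≢β missα missβ ¬aw λ yv →
              Between-functional proper y≢v y≢w v≢w yv yw
          in
          partner j₄ j₂ j₃ (λ e n₁ n₄ n₂ n₃ → n₁ , n₂ , n₃ , n₄) (≢-sym b≢d) (≢-sym c≢d) b≢c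
            (λ ab → partner j₂ j₃ j₄ (λ e n₁ n₂ n₃ n₄ → n₁ , n₂ , n₃ , n₄) b≢c b≢d c≢d
              (Between-functional proper a≢b a≢c b≢c ab) (Between-functional proper a≢b a≢d b≢d ab))
            (λ ac → partner j₃ j₂ j₄ (λ e n₁ n₃ n₂ n₄ → n₁ , n₂ , n₃ , n₄) (≢-sym b≢c) c≢d b≢d
              (Between-functional proper a≢c a≢b (≢-sym b≢c) ac) (Between-functional proper a≢c a≢d c≢d ac))
          where
          distinct : Distinct q₁ q₂ q₃ q₄
          distinct = ends≢⇒≢ j₁ j₂ a≢b , ends≢⇒≢ j₁ j₃ a≢c , ends≢⇒≢ j₁ j₄ a≢d ,
            ends≢⇒≢ j₂ j₃ b≢c , ends≢⇒≢ j₂ j₄ b≢d , ends≢⇒≢ j₃ j₄ c≢d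

        -- `q₃` and `q₄` take `α` and `β` in either order. As no colour at `a` leads to both `b` and
        -- `c`, both orders are blocked only if `α` and `β` both lie on `ab` or both on `ac`.
        missing-pair : ∀ {q₁ q₂ q₃ q₄ a b c φ α β} → Proper (Off q₁ q₂ q₃ q₄) φ →
          Join q₁ x a → Join q₂ x a → Join q₃ x b → Join q₄ x c → a ≢ b → a ≢ c → b ≢ c →
          α ≢ β → Missing (Off q₁ q₂ q₃ q₄) φ x α → Missing (Off q₁ q₂ q₃ q₄) φ x β →
          (Between (Off q₁ q₂ q₃ q₄) φ a b α → Between (Off q₁ q₂ q₃ q₄) φ a b β → ⊥) →
          (Between (Off q₁ q₂ q₃ q₄) φ a c α → Between (Off q₁ q₂ q₃ q₄) φ a c β → ⊥) → ⊥
        missing-pair {q₁} {q₂} {q₃} {q₄} proper j₁ j₂ j₃ j₄ a≢b a≢c b≢c α≢β missα missβ ¬ab ¬ac =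
          recolour₂ proper j₃ j₄ j₁ j₂ cover α≢β missα missβ
            (λ baα → recolour₂ proper j₃ j₄ j₁ j₂ cover (≢-sym α≢β) missβ missα
              (λ baβ → ¬ab (Between-swap baα) (Between-swap baβ))
              (λ caα → Between-functional proper a≢b a≢c b≢c (Between-swap baα) (Between-swap caα)))
            (λ caβ → recolour₂ proper j₃ j₄ j₁ j₂ cover (≢-sym α≢β) missβ missα
              (λ baβ → Between-functional proper a≢b a≢c b≢c (Between-swap baβ) (Between-swap caβ))
              (λ caα → ¬ac (Between-swap caα) (Between-swap caβ)))
          where
          cover : ∀ e → e ≢ q₃ → e ≢ q₄ → e ≢ q₁ → e ≢ q₂ → Off q₁ q₂ q₃ q₄ e
          cover e n₃ n₄ n₁ n₂ = n₁ , n₂ , n₃ , n₄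

        -- If γ lives on an xc-edge f but not on ab, then f and q₄ can take α and β, releasing γ for q₁ or for q₃.
        -- Both fail only if the γ-edges at a and at b meet the α-edge at c; they would then be one and the same ab-edge.
        release : ∀ {q₁ q₂ q₃ q₄ f a b c φ α β} → Proper (Off q₁ q₂ q₃ q₄) φ →
          Join q₁ x a → Join q₂ x a → Join q₃ x b → Join q₄ x c → a ≢ b → a ≢ c → b ≢ c →
          α ≢ β → Missing (Off q₁ q₂ q₃ q₄) φ x α → Missing (Off q₁ q₂ q₃ q₄) φ x β →
          Between (Off q₁ q₂ q₃ q₄) φ a b α → Between (Off q₁ q₂ q₃ q₄) φ a b β →
          Off q₁ q₂ q₃ q₄ f → Join f x c → ¬ Between (Off q₁ q₂ q₃ q₄) φ a b (φ f) → ⊥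
        release {q₁} {q₂} {q₃} {q₄} {f} {a} {b} {c} {φ} {α} {β}
          proper j₁ j₂ j₃ j₄ a≢b a≢c b≢c α≢β missα missβ abα abβ Pf jf@(xf , cf , x≢c) ¬abγ =
          recolour₃ proper j₁ jf j₄ j₂ j₃ (λ e n₁ n₄ n₂ n₃ → n₁ , n₂ , n₃ , n₄) Pf refl α≢β missα missβ
            ¬abγ ¬cbα ¬caβ λ h g v Ph Pg γh ah αg cg vh vg →
          recolour₃ proper j₃ jf j₄ j₁ j₂ (λ e n₃ n₄ n₁ n₂ → n₁ , n₂ , n₃ , n₄) Pf refl α≢β missα missβ
            (¬abγ ∘ Between-swap) ¬caα ¬caβ λ h′ g′ v′ Ph′ Pg′ γh′ bh′ αg′ cg′ v′h′ v′g′ →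
          meet Ph Pg γh ah αg cg vh vg Ph′ Pg′ γh′ bh′ αg′ cg′ v′h′ v′g′
          where
          P : E → Set
          P = Off q₁ q₂ q₃ q₄
          ¬caα : ¬ Between P φ c a α
          ¬caα = Between-functional proper a≢b a≢c b≢c abα ∘ Between-swap
          ¬caβ : ¬ Between P φ c a β
          ¬caβ = Between-functional proper a≢b a≢c b≢c abβ ∘ Between-swap
          ¬cbα : ¬ Between P φ c b α
          ¬cbα = Between-functional proper (≢-sym a≢b) b≢c a≢c (Between-swap abα) ∘ Between-swap
          ¬at-c : ∀ {h w} → P h → φ h ≡ φ f → Inc w h → x ≢ w → w ≢ c → ¬ Inc c h
          ¬at-c Ph γh wh x≢w w≢c ch with same-colour⇒≡ proper Ph Pf ch cf γh
          ... | refl = no-third-end xf wh ch x≢w x≢c w≢c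
          meet : ∀ {h g v h′ g′ v′} → P h → P g → φ h ≡ φ f → Inc a h → φ g ≡ α → Inc c g → Inc v h → Inc v g →
            P h′ → P g′ → φ h′ ≡ φ f → Inc b h′ → φ g′ ≡ α → Inc c g′ → Inc v′ h′ → Inc v′ g′ → ⊥
          meet {v = v} {v′ = v′} Ph Pg γh ah αg cg vh vg Ph′ Pg′ γh′ bh′ αg′ cg′ v′h′ v′g′
            with same-colour⇒≡ proper Pg Pg′ cg cg′ (trans αg (sym αg′)) | v ≟ c | v′ ≟ c | v ≟ v′
          ... | refl | yes refl | _        | _        = ¬at-c Ph γh ah (proj₂ (proj₂ j₁)) a≢c vh
          ... | refl | no _     | yes refl | _        = ¬at-c Ph′ γh′ bh′ (proj₂ (proj₂ j₃)) b≢c v′h′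
          ... | refl | no v≢c   | no v′≢c  | no v≢v′  = no-third-end vg v′g′ cg v≢v′ v≢c v′≢c
          ... | refl | no _     | no _     | yes refl with same-colour⇒≡ proper Ph Ph′ vh v′h′ (trans γh (sym γh′))
          ... | refl = ¬abγ (_ , Ph , γh , ah , bh′)

        ends-aabc-tight : ∀ {q₁ q₂ q₃ q₄ a b c φ α β} → q₁ ≢ q₂ → Proper (Off q₁ q₂ q₃ q₄) φ →
          Join q₁ x a → Join q₂ x a → Join q₃ x b → Join q₄ x c → a ≢ b → a ≢ c → b ≢ c →
          α ≢ β → Missing (Off q₁ q₂ q₃ q₄) φ x α → Missing (Off q₁ q₂ q₃ q₄) φ x β →
          Between (Off q₁ q₂ q₃ q₄) φ a b α → Between (Off q₁ q₂ q₃ q₄) φ a b β → ⊥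
        ends-aabc-tight {q₁} {q₂} {q₃} {q₄} {a} {b} {c} {φ} {α} {β}
          q₁≢q₂ proper j₁ j₂ j₃ j₄ a≢b a≢c b≢c α≢β missα missβ abα abβ =
          unused-colour {q₄ = q₄} φ (triangle x a b) (triangle-clique x a b)
            q₁≢q₂ (ends≢⇒≢ j₁ j₃ a≢b) (ends≢⇒≢ j₂ j₃ a≢b)
            (∈-subset⁺ T? (inj₁ j₁)) (∈-subset⁺ T? (inj₁ j₂)) (∈-subset⁺ T? (inj₂ (inj₁ j₃)))
            λ γ unused → stuck γ λ e Pe inT → unused e Pe (∈-subset⁺ T? inT)
          where
          T? : Decidable (InTriangle x a b)
          T? = InTriangle? x a b
          P : E → Set
          P = Off q₁ q₂ q₃ q₄
          stuck : ∀ γ → (∀ e → P e → InTriangle x a b e → φ e ≢ γ) → ⊥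
          stuck γ unused = missing-pair proper j₁ j₂ j₃ j₄ a≢b a≢c b≢c α≢γ missα missγ
            (λ _ → ¬abγ) (λ acα _ → Between-functional proper a≢b a≢c b≢c abα acα)
            where
            ¬abγ : ¬ Between P φ a b γ
            ¬abγ (e , Pe , γe , ae , be) = unused e Pe (inj₂ (inj₂ (ae , be , a≢b))) γe
            α≢γ : α ≢ γ
            α≢γ refl = ¬abγ abα
            missγ : Missing P φ x γ
            missγ f Pf xf refl with other-end xf
            ... | y , jf with y ≟ a | y ≟ b | y ≟ c
            ... | yes refl | _        | _        = unused f Pf (inj₁ jf) refl
            ... | no _     | yes refl | _        = unused f Pf (inj₂ (inj₁ jf)) refl
            ... | no _     | no _     | yes refl =
              release proper j₁ j₂ j₃ j₄ a≢b a≢c b≢c α≢β missα missβ abα abβ Pf jf ¬abγ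
            ... | no y≢a   | no y≢b   | no y≢c   =
              ends-abcd j₁ j₃ j₄ jf a≢b a≢c (≢-sym y≢a) b≢c (≢-sym y≢b) (≢-sym y≢c)

        ends-aabc : ∀ {q₁ q₂ q₃ q₄ a b c} → q₁ ≢ q₂ →
          Join q₁ x a → Join q₂ x a → Join q₃ x b → Join q₄ x c → a ≢ b → a ≢ c → b ≢ c → ⊥
        ends-aabc {q₁} {q₂} {q₃} {q₄} q₁≢q₂ j₁ j₂ j₃ j₄ a≢b a≢c b≢c =
          colour-off distinct (proj₁ j₁) (proj₁ j₂) (proj₁ j₃) (proj₁ j₄) λ (φ , proper) →
          two-missing-colours φ x distinct (proj₁ j₁) (proj₁ j₂) (proj₁ j₃) (proj₁ j₄) λ α β α≢β missα missβ →
          missing-pair proper j₁ j₂ j₃ j₄ a≢b a≢c b≢c α≢β missα missβ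
            (ends-aabc-tight q₁≢q₂ proper j₁ j₂ j₃ j₄ a≢b a≢c b≢c α≢β missα missβ)
            λ (e , Pe , rest) (f , Pf , rest′) →
              -- If both colours lie on `ac`, the roles of `q₃` and `q₄` are exchanged.
              ends-aabc-tight q₁≢q₂ (λ e f Pe Pf → proper e f (swap Pe) (swap Pf)) j₁ j₂ j₄ j₃ a≢c a≢b (≢-sym b≢c)
                α≢β (λ e → missα e ∘ swap) (λ e → missβ e ∘ swap) (e , swap Pe , rest) (f , swap Pf , rest′)
          where
          swap : ∀ {q₁ q₂ q₃ q₄ e} → Off q₁ q₂ q₃ q₄ e → Off q₁ q₂ q₄ q₃ e
          swap (n₁ , n₂ , n₃ , n₄) = n₁ , n₂ , n₄ , n₃
          distinct : Distinct q₁ q₂ q₃ q₄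
          distinct = q₁≢q₂ , ends≢⇒≢ j₁ j₃ a≢b , ends≢⇒≢ j₁ j₄ a≢c ,
            ends≢⇒≢ j₂ j₃ a≢b , ends≢⇒≢ j₂ j₄ a≢c , ends≢⇒≢ j₃ j₄ b≢c

        ends-aabb : ∀ {q₁ q₂ q₃ q₄ a b} → q₁ ≢ q₂ → q₃ ≢ q₄ →
          Join q₁ x a → Join q₂ x a → Join q₃ x b → Join q₄ x b → a ≢ b → ⊥
        ends-aabb {q₁} {q₂} {q₃} {q₄} {a} {b} q₁≢q₂ q₃≢q₄ j₁ j₂ j₃ j₄ a≢b =
          colour-off distinct (proj₁ j₁) (proj₁ j₂) (proj₁ j₃) (proj₁ j₄) λ (φ , proper) →
          two-unused-colours φ (triangle x a b) (triangle-clique x a b) distinct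
            (∈-subset⁺ T? (inj₁ j₁)) (∈-subset⁺ T? (inj₁ j₂)) (∈-subset⁺ T? (inj₂ (inj₁ j₃))) (∈-subset⁺ T? (inj₂ (inj₁ j₄)))
            λ α β α≢β unusedα unusedβ →
          recolour₂ proper j₁ j₃ j₄ j₂ (λ e n₁ n₃ n₄ n₂ → n₁ , n₂ , n₃ , n₄) α≢β
            (λ e Pe xe → unusedα e Pe (∈-subset⁺ T? (at-x xe)))
            (λ e Pe xe → unusedβ e Pe (∈-subset⁺ T? (at-x xe)))
            (λ (e , Pe , αe , ae , be) → unusedα e Pe (∈-subset⁺ T? (inj₂ (inj₂ (ae , be , a≢b)))) αe)
            (λ (e , Pe , βe , be , ae) → unusedβ e Pe (∈-subset⁺ T? (inj₂ (inj₂ (ae , be , a≢b)))) βe)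
          where
          T? : Decidable (InTriangle x a b)
          T? = InTriangle? x a b
          at-x : ∀ {e} → Inc x e → InTriangle x a b e
          at-x xe with other-end xe
          ... | y , je with y ≟ a | y ≟ b
          ... | yes refl | _        = inj₁ je
          ... | no _     | yes refl = inj₂ (inj₁ je)
          ... | no y≢a   | no y≢b   = ⊥-elim (ends-aabc q₁≢q₂ j₁ j₂ j₃ je a≢b (≢-sym y≢a) (≢-sym y≢b))
          distinct : Distinct q₁ q₂ q₃ q₄
          distinct = q₁≢q₂ , ends≢⇒≢ j₁ j₃ a≢b , ends≢⇒≢ j₁ j₄ a≢b ,
            ends≢⇒≢ j₂ j₃ a≢b , ends≢⇒≢ j₂ j₄ a≢b , q₃≢q₄

        ends-aaab : ∀ {q₁ q₂ q₃ q₄ a b} → q₁ ≢ q₂ → q₁ ≢ q₃ → q₂ ≢ q₃ →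
          Join q₁ x a → Join q₂ x a → Join q₃ x a → Join q₄ x b → a ≢ b → ⊥
        ends-aaab {q₁} {q₂} {q₃} {q₄} {a} {b} q₁≢q₂ q₁≢q₃ q₂≢q₃ j₁ j₂ j₃ j₄ a≢b =
          colour-off distinct (proj₁ j₁) (proj₁ j₂) (proj₁ j₃) (proj₁ j₄) λ (φ , proper) →
          unused-colour {q₄ = q₄} φ (star a) (star-clique a id) q₁≢q₂ q₁≢q₃ q₂≢q₃ (∈-subset⁺ (Inc? a) (proj₁ (proj₂ j₁)))
            (∈-subset⁺ (Inc? a) (proj₁ (proj₂ j₂))) (∈-subset⁺ (Inc? a) (proj₁ (proj₂ j₃))) λ α unusedα →
          two-unused-colours φ (triangle x a b) (triangle-clique x a b) distinct
            (∈-subset⁺ T? (inj₁ j₁)) (∈-subset⁺ T? (inj₁ j₂)) (∈-subset⁺ T? (inj₁ j₃)) (∈-subset⁺ T? (inj₂ (inj₁ j₄)))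
            λ β β′ β≢β′ unusedβ unusedβ′ →
          -- The triangle offers two colours, so one of them differs from `α`.
          finish proper unusedα unusedβ λ { refl → finish proper unusedα unusedβ′ β≢β′ }
          where
          P : E → Set
          P = Off q₁ q₂ q₃ q₄
          T? : Decidable (InTriangle x a b)
          T? = InTriangle? x a b
          at-x : ∀ {e} → P e → Inc x e → Join e x a
          at-x {e} (_ , _ , _ , e≢q₄) xe with other-end xe
          ... | y , je with y ≟ a | y ≟ b
          ... | yes refl | _        = je
          ... | no _     | yes refl = ⊥-elim (ends-aabb q₁≢q₂ e≢q₄ j₁ j₂ je j₄ a≢b)
          ... | no y≢a   | no y≢b   = ⊥-elim (ends-aabc q₁≢q₂ j₁ j₂ j₄ je a≢b (≢-sym y≢a) (≢-sym y≢b))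
          finish : ∀ {φ α β} → Proper P φ → Unused P φ (star a) α → Unused P φ (triangle x a b) β → α ≢ β → ⊥
          finish proper unusedα unusedβ α≢β =
            recolour₂ proper j₁ j₄ j₂ j₃ (λ e n₁ n₄ n₂ n₃ → n₁ , n₂ , n₃ , n₄) α≢β
              (λ e Pe xe → unusedα e Pe (∈-subset⁺ (Inc? a) (proj₁ (proj₂ (at-x Pe xe)))))
              (λ e Pe xe → unusedβ e Pe (∈-subset⁺ T? (inj₁ (at-x Pe xe))))
              (λ (e , Pe , αe , ae , _) → unusedα e Pe (∈-subset⁺ (Inc? a) ae) αe)
              (λ (e , Pe , βe , be , ae) → unusedβ e Pe (∈-subset⁺ T? (inj₂ (inj₂ (ae , be , a≢b)))) βe)
          distinct : Distinct q₁ q₂ q₃ q₄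
          distinct = q₁≢q₂ , q₁≢q₃ , ends≢⇒≢ j₁ j₄ a≢b , q₂≢q₃ , ends≢⇒≢ j₂ j₄ a≢b , ends≢⇒≢ j₃ j₄ a≢b

        -- By `ends-aaab` all edges at `x` end in `a`, so two colours missing at `a` are missing at
        -- `x` as well, and no edge has to move.
        ends-aaaa : ∀ {q₁ q₂ q₃ q₄ a} → Distinct q₁ q₂ q₃ q₄ →
          Join q₁ x a → Join q₂ x a → Join q₃ x a → Join q₄ x a → ⊥
        ends-aaaa {q₁} {q₂} {q₃} {q₄} {a} distinct@(q₁≢q₂ , q₁≢q₃ , _ , q₂≢q₃ , _) j₁ j₂ j₃ j₄ =
          colour-off distinct (proj₁ j₁) (proj₁ j₂) (proj₁ j₃) (proj₁ j₄) λ (φ , proper) →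
          two-missing-colours φ a distinct (proj₁ (proj₂ j₁)) (proj₁ (proj₂ j₂)) (proj₁ (proj₂ j₃)) (proj₁ (proj₂ j₄))
            λ α β α≢β missα missβ →
          recolour₂ proper j₁ j₂ j₃ j₄ (λ e n₁ n₂ n₃ n₄ → n₁ , n₂ , n₃ , n₄) α≢β
            (λ e Pe xe → missα e Pe (at-a xe)) (λ e Pe xe → missβ e Pe (at-a xe))
            (λ (e , Pe , αe , ae , _) → missα e Pe ae αe) (λ (e , Pe , βe , ae , _) → missβ e Pe ae βe)
          where
          at-a : ∀ {e} → Inc x e → Inc a e
          at-a xe with other-end xe
          ... | y , je with y ≟ a
          ... | yes refl = proj₁ (proj₂ je)
          ... | no y≢a   = ⊥-elim (ends-aaab q₁≢q₂ q₁≢q₃ q₂≢q₃ j₁ j₂ j₃ je (≢-sym y≢a))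

        -- Up to a permutation of the edges, the far ends show one of the five patterns.
        four-edges : ∀ {q₁ q₂ q₃ q₄} → Distinct q₁ q₂ q₃ q₄ → Inc x q₁ → Inc x q₂ → Inc x q₃ → Inc x q₄ → ⊥
        four-edges D@(d₁₂ , d₁₃ , d₁₄ , d₂₃ , d₂₄ , d₃₄) i₁ i₂ i₃ i₄
          with other-end i₁ | other-end i₂ | other-end i₃ | other-end i₄
        ... | a , j₁ | b , j₂ | c , j₃ | d , j₄ with a ≟ b | a ≟ c | a ≟ d
        ... | yes refl | yes refl | yes refl = ends-aaaa D j₁ j₂ j₃ j₄
        ... | yes refl | yes refl | no a≢d   = ends-aaab d₁₂ d₁₃ d₂₃ j₁ j₂ j₃ j₄ a≢d
        ... | yes refl | no a≢c   | yes refl = ends-aaab d₁₂ d₁₄ d₂₄ j₁ j₂ j₄ j₃ a≢c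
        ... | no a≢b   | yes refl | yes refl = ends-aaab d₁₃ d₁₄ d₃₄ j₁ j₃ j₄ j₂ a≢b
        ... | yes refl | no a≢c   | no a≢d   with c ≟ d
        ...   | yes refl = ends-aabb d₁₂ d₃₄ j₁ j₂ j₃ j₄ a≢c
        ...   | no c≢d   = ends-aabc d₁₂ j₁ j₂ j₃ j₄ a≢c a≢d c≢d
        four-edges D@(d₁₂ , d₁₃ , d₁₄ , d₂₃ , d₂₄ , d₃₄) i₁ i₂ i₃ i₄
          | a , j₁ | b , j₂ | c , j₃ | d , j₄ | no a≢b | yes refl | no a≢d with b ≟ d
        ...   | yes refl = ends-aabb d₁₃ d₂₄ j₁ j₃ j₂ j₄ a≢b
        ...   | no b≢d   = ends-aabc d₁₃ j₁ j₃ j₂ j₄ a≢b a≢d b≢d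
        four-edges D@(d₁₂ , d₁₃ , d₁₄ , d₂₃ , d₂₄ , d₃₄) i₁ i₂ i₃ i₄
          | a , j₁ | b , j₂ | c , j₃ | d , j₄ | no a≢b | no a≢c | yes refl with b ≟ c
        ...   | yes refl = ends-aabb d₁₄ d₂₃ j₁ j₄ j₂ j₃ a≢b
        ...   | no b≢c   = ends-aabc d₁₄ j₁ j₄ j₂ j₃ a≢b a≢c b≢c
        four-edges D@(d₁₂ , d₁₃ , d₁₄ , d₂₃ , d₂₄ , d₃₄) i₁ i₂ i₃ i₄
          | a , j₁ | b , j₂ | c , j₃ | d , j₄ | no a≢b | no a≢c | no a≢d with b ≟ c | b ≟ d | c ≟ d
        ...   | yes refl | yes refl | _        = ends-aaab d₂₃ d₂₄ d₃₄ j₂ j₃ j₄ j₁ (≢-sym a≢b)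
        ...   | yes refl | no b≢d   | _        = ends-aabc d₂₃ j₂ j₃ j₁ j₄ (≢-sym a≢b) b≢d a≢d
        ...   | no b≢c   | yes refl | _        = ends-aabc d₂₄ j₂ j₄ j₁ j₃ (≢-sym a≢b) b≢c a≢c
        ...   | no b≢c   | no b≢d   | yes refl = ends-aabc d₃₄ j₃ j₄ j₁ j₂ (≢-sym a≢c) (≢-sym b≢c) a≢b
        ...   | no b≢c   | no b≢d   | no c≢d   = ends-abcd j₁ j₂ j₃ j₄ a≢b a≢c a≢d b≢c b≢d c≢d

-- From a hypothetical counterexample with `s = 4 + r` to a contradiction

module Counterexample (r t : ℕ) (4+r≤t : 4 + r ≤ t) (G : Multigraph)
  (uncolourable : ¬ Colourable (Fin (m G)) (LAdj G) (2 + (r + t)))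
  (bound : ∀ Q → IsClique (LAdj G) Q → ∣ Q ∣ ≤ 2 + (r + t))
  (colour-off-clique : ∀ Q → IsClique (LAdj G) Q → ∣ Q ∣ ≡ 4 + r → ¬ ¬ LineGraph.PartialColouring G (_∉ Q) t) where

  open LineGraph G
  open Recolouring (r + t) uncolourable
  open CliqueBound bound

  module _ {q₁ q₂ q₃ q₄ : E} where

    quad : Subset (m G)
    quad = (((∅ ∪ ⁅ q₁ ⁆) ∪ ⁅ q₂ ⁆) ∪ ⁅ q₃ ⁆) ∪ ⁅ q₄ ⁆

    ∣quad∣≡4 : Distinct q₁ q₂ q₃ q₄ → ∣ quad ∣ ≡ 4
    ∣quad∣≡4 (d₁₂ , d₁₃ , d₁₄ , d₂₃ , d₂₄ , d₃₄) =
      trans (∣p∪⁅x⁆∣≡1+∣p∣ (∉-∪-⁅⁆ (∉-∪-⁅⁆ (∉-∪-⁅⁆ ∉⊥ (≢-sym d₁₄)) (≢-sym d₂₄)) (≢-sym d₃₄)))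
        (cong suc (trans (∣p∪⁅x⁆∣≡1+∣p∣ (∉-∪-⁅⁆ (∉-∪-⁅⁆ ∉⊥ (≢-sym d₁₃)) (≢-sym d₂₃)))
          (cong suc (trans (∣p∪⁅x⁆∣≡1+∣p∣ (∉-∪-⁅⁆ ∉⊥ (≢-sym d₁₂)))
            (cong suc (trans (∣p∪⁅x⁆∣≡1+∣p∣ {x = q₁} ∉⊥) (cong suc (∣⊥∣≡0 (m G)))))))))

    Off⇒∉quad : ∀ {e} → Off q₁ q₂ q₃ q₄ e → e ∉ quad
    Off⇒∉quad (n₁ , n₂ , n₃ , n₄) = ∉-∪-⁅⁆ (∉-∪-⁅⁆ (∉-∪-⁅⁆ (∉-∪-⁅⁆ ∉⊥ n₁) n₂) n₃) n₄

    quad⊆star : ∀ {x} → Inc x q₁ → Inc x q₂ → Inc x q₃ → Inc x q₄ → quad ⊆ star x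
    quad⊆star {x} i₁ i₂ i₃ i₄ {e} e∈ = ∈-subset⁺ (Inc? x) (decidable-stable (Inc? x e) λ ¬i →
      Off⇒∉quad ((λ { refl → ¬i i₁ }) , (λ { refl → ¬i i₂ }) , (λ { refl → ¬i i₃ }) , (λ { refl → ¬i i₄ })) e∈)

    -- The four edges grow to a clique of size `4 + r` inside the star. Off that clique `t` colours
    -- suffice, and its `r` further edges get private colours. The double negation is harmless, as
    -- every use has goal `⊥`.
    colour-off : ∀ {x} → 4 + r ≤ ∣ star x ∣ → Distinct q₁ q₂ q₃ q₄ →
      Inc x q₁ → Inc x q₂ → Inc x q₃ → Inc x q₄ → ¬ ¬ PartialColouring (Off q₁ q₂ q₃ q₄) (r + t)
    colour-off {x} large d i₁ i₂ i₃ i₄ none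
      with extend-within r quad (star x) (quad⊆star i₁ i₂ i₃ i₄) (subst (_≤ ∣ star x ∣) 4+r≡ large)
      where
      4+r≡ : 4 + r ≡ r + ∣ quad ∣
      4+r≡ = trans (ℕ.+-comm 4 r) (cong (r +_) (sym (∣quad∣≡4 d)))
    ... | Q , Q⊆star , ∣Q∣≡ , colour =
      colour-off-clique Q (star-clique x Q⊆star) (trans ∣Q∣≡ (trans (cong (r +_) (∣quad∣≡4 d)) (ℕ.+-comm r 4)))
        λ partial → let c , proper = colour partial in
          none (c , λ e f Pe Pf → proper e f (Off⇒∉quad Pe) (Off⇒∉quad Pf))

  no-large-star : ∀ x → ¬ 4 + r ≤ ∣ star x ∣
  no-large-star x large with ≤⇒injection {r = 4} (star x) (ℕ.≤-trans (ℕ.m≤m+n 4 r) large)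
  ... | q , inj , q∈ = AtVertex.four-edges x (colour-off large)
    ( (λ eq → contradiction (inj _ _ eq) λ ()) , (λ eq → contradiction (inj _ _ eq) λ ())
    , (λ eq → contradiction (inj _ _ eq) λ ()) , (λ eq → contradiction (inj _ _ eq) λ ())
    , (λ eq → contradiction (inj _ _ eq) λ ()) , (λ eq → contradiction (inj _ _ eq) λ ()) )
    (at zero) (at (suc zero)) (at (suc (suc zero))) (at (suc (suc (suc zero))))
    where
    at : ∀ i → Inc x (q i)
    at i = ∈-subset⁻ (Inc? x) (q∈ i)

  impossible : ⊥
  impossible = uncolourable (greedy (λ x → ℕ.≤-pred (ℕ.≰⇒> (no-large-star x))) small)
    where
    -- All degrees are at most s - 1, and 2(s - 1) ≤ s + t - 2 amounts to s ≤ t.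
    small : (3 + r) + (3 + r) ≤ 2 + (r + t)
    small = subst (_≤ 2 + (r + t)) (cong (2 +_) (ℕ.+-suc r (3 + r))) (s≤s (s≤s (ℕ.+-monoʳ-≤ r 4+r≤t)))

-- Edges of `Q` get the default `zero`, whence `suc t`. Since `c` might depend on the proof of
-- `e ∉ Q`, the proof supplied by `e ∈? Q` is used throughout.
colourable⇒partialColouring : ∀ G Q {j t} → j ≤ suc t → Colourable (LMinusV G Q) (LMinusAdj G Q) j →
  LineGraph.PartialColouring G (_∉ Q) (suc t)
colourable⇒partialColouring G Q {j} {t} j≤ (c , proper) = c′ , proper′
  where
  c′ : Fin (m G) → Fin (suc t)
  c′ e with e ∈? Q
  ... | yes _  = zero
  ... | no e∉Q = inject≤ (c (e , e∉Q)) j≤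
  proper′ : LineGraph.Proper G (_∉ Q) c′
  proper′ e f e∉ f∉ adj with e ∈? Q | f ∈? Q
  ... | yes e∈ | _      = contradiction e∈ e∉
  ... | no _   | yes f∈ = contradiction f∈ f∉
  ... | no e∉Q | no f∉Q = proper (e , e∉Q) (f , f∉Q) adj ∘ inject≤-injective j≤ j≤ _ _

theorem2 : (s t : ℕ) → 4 ≤ s → s ≤ t → (G : Multigraph) →
    HasChromaticNumber (Fin (m G)) (LAdj G) (s + t ∸ 1) →
    (Σ ℕ λ w → HasCliqueNumber (LAdj G) w × w < s + t ∸ 1) →
    Σ (Subset (m G)) λ Q → IsClique (LAdj G) Q × ∣ Q ∣ ≡ s ×
    ChromaticAtLeast (LMinusV G Q) (LMinusAdj G Q) (t + 1)
theorem2 (suc (suc (suc (suc r)))) t@(suc _) (s≤s (s≤s (s≤s (s≤s z≤n)))) s≤t G (_ , below) (w , (_ , ω) , w<)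
  -- Everything is decidable, so the clique is found by search; a failed search says that every
  -- clique of size s leaves a `t`-colourable rest.
  with anySubset? (λ Q → LineGraph.isClique? G Q ×-dec (∣ Q ∣ ℕ.≟ 4 + r) ×-dec ¬? (LineGraph.partialColouring? G Q t))
... | yes (Q , clique , size , uncolourable) = Q , clique , size , λ j j<t+1 colouring →
  uncolourable (colourable⇒partialColouring G Q (ℕ.≤-pred (subst (j <_) (ℕ.+-comm t 1) j<t+1)) colouring)
... | no none = ⊥-elim (Counterexample.impossible r t s≤t G
  -- `s + t ∸ 1` computes to `3 + (r + t)`, so `2 + (r + t)` colours are one too few, and cliques
  -- have at most that many edges.
  (below (2 + (r + t)) ℕ.≤-refl)
  (λ Q clique → ℕ.≤-trans (ω Q clique) (ℕ.≤-pred w<))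
  (λ Q clique size uncolourable → none (Q , clique , size , uncolourable)))
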